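{- Let $ufe$ be a union-find-explain data structure and $x,y\in\mathbb{N}$ with $\{x,y\}\subseteq\mathrm{Field}(\mathsf{ufe\_\alpha}\ ufe)$ and $\mathsf{ufe\_rep\_of}\ ufe\ x=\mathsf{ufe\_rep\_of}\ ufe\ y$. Then $\mathsf{explain}\ ufe\ x\ y=\mathsf{explain'}\ ufe\ x\ y$.
   Context: Union-find (UF) data structures. A UF data structure $uf$ is a finite list $l$ of natural numbers, of length $n$, such that for every $i<n$ we have $l\,!\,i<n$ and following parents from $i$ eventually reaches a root, i.e. an index $j$ with $l\,!\,j=j$. For $i<n$, $\mathsf{ufa\_parent\_of}\ uf\ i=l\,!\,i$, and $\mathsf{ufa\_rep\_of}\ uf\ i$ is the root reached from $i$. The represented partial equivalence relation is $\mathsf{ufa\_\alpha}\ uf=\{(x,y)\mid x,y<n,\ \mathsf{ufa\_rep\_of}\ uf\ x=\mathsf{ufa\_rep\_of}\ uf\ y\}$; its field $\mathrm{Field}(\mathsf{ufa\_\alpha}\ uf)$ is $\{0,\dots,n-1\}$. For $x,y<n$, $\mathsf{ufa\_union}\ uf\ x\ y$ is the list obtained from $l$ by setting the entry at index $\mathsf{ufa\_rep\_of}\ uf\ x$ to $\mathsf{ufa\_rep\_of}\ uf\ y$. $\mathsf{eff\_union}\ uf\ a\ b$ means $a,b\in\mathrm{Field}(\mathsf{ufa\_\alpha}\ uf)$ and $\mathsf{ufa\_rep\_of}\ uf\ a\neq\mathsf{ufa\_rep\_of}\ uf\ b$. $\mathsf{ufa\_unions}\ uf\ us$ performs the unions in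 the list of pairs $us$ from left to right, and $\mathsf{eff\_unions}\ uf\ us$ means that each pair in $us$ is an effective union with respect to the UF data structure resulting from $uf$ by performing all preceding unions of $us$. Union-find-explain (UFE) data structures. A UFE data structure $ufe$ is a pair $(uf,us)$ with $\mathsf{ufa\_\alpha}\ uf\subseteq\mathrm{Id}$ and $\mathsf{eff\_unions}\ uf\ us$. Put $\mathsf{unions}\ ufe=us$, $\mathsf{uf\_ds}\ ufe=\mathsf{ufa\_unions}\ uf\ us$, and for $F\in\{\mathsf{rep\_of},\mathsf{parent\_of},\mathsf{\alpha},\mathsf{lca}\}$ let $\mathsf{ufe\_}F\ ufe=\mathsf{ufa\_}F(\mathsf{uf\_ds}\ ufe)$. For an effective union, $\mathsf{ufe\_union}\ ufe\ a\ b=(uf,us\,@\,[(a,b)])$; $\mathsf{rollback}\ ufe$ removes the last pair from $us$. Proof terms are generated by $\mathsf{AssmP}\ i$, $\mathsf{ReflP}\ x$, $\mathsf{SymP}\ p$, $p_1\bigtriangledown p_2$; repeated $\bigtriangledown$ is parenthesised according to one fixed associativity convention, the same everywhere. The function $\mathsf{explain}$. $\mathsf{explain}\ ufe\ x\ y=\mathsf{ReflP}\ x$ if $\mathsf{unions}\ ufe=[\,]$. Otherwise let $ufe_0=\mathsf{rollback}\ ufe$, let $(a,b)$ be the last element of $\mathsf{unions}\ ufe$, and $q=\mathsf{AssmP}\ |\mathsf{unions}\ ufe_0|$. Then $\mathsf{explain}\ ufe\ x\ y$ is: $\mathsf{explain}\ ufe_0\ x\ y$ if $\mathsf{ufe\_rep\_of}\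 ufe_0\ x=\mathsf{ufe\_rep\_of}\ ufe_0\ y$; else $\mathsf{explain}\ ufe_0\ x\ a\bigtriangledown q\bigtriangledown\mathsf{explain}\ ufe_0\ b\ y$ if $\mathsf{ufe\_rep\_of}\ ufe_0\ x=\mathsf{ufe\_rep\_of}\ ufe_0\ a$; else $\mathsf{explain}\ ufe_0\ x\ b\bigtriangledown\mathsf{SymP}\ q\bigtriangledown\mathsf{explain}\ ufe_0\ a\ y$. LCA. $\mathsf{awalk\_verts\_from\_rep}\ uf\ x$ is the list of vertices on the path from the representative of $x$ to $x$: with $p=\mathsf{ufa\_parent\_of}\ uf\ x$ it equals $[x]$ if $p=x$, and $\mathsf{awalk\_verts\_from\_rep}\ uf\ p\ @\ [x]$ otherwise. $\mathsf{ufa\_lca}\ uf\ x\ y$ is the last element of the longest common prefix of $\mathsf{awalk\_verts\_from\_rep}\ uf\ x$ and $\mathsf{awalk\_verts\_from\_rep}\ uf\ y$. Associated unions. $\mathsf{au\_ds}\ ufe:\mathbb{N}\to\mathbb{N}\ \mathsf{option}$ is characterised by: if $\mathsf{unions}\ ufe=[\,]$ then $\mathsf{au\_ds}\ ufe\ z=\mathsf{None}$ for all $z$; and if $\mathsf{eff\_union}\ (\mathsf{uf\_ds}\ ufe)\ a\ b$ then $\mathsf{au\_ds}\ (\mathsf{ufe\_union}\ ufe\ a\ b)$ agrees with $\mathsf{au\_ds}\ ufe$ except that it maps $\mathsf{ufe\_rep\_of}\ ufe\ a$ to $\mathsf{Some}\ |\mathsf{unions}\ ufe|$. $\mathsf{find\_newest\_on\_path}\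 ufe\ y\ x$ (with $y$ an ancestor of $x$) is $\mathsf{None}$ if $y=x$, and otherwise $\max(\mathsf{au\_ds}\ ufe\ x,\ \mathsf{find\_newest\_on\_path}\ ufe\ y\ (\mathsf{ufe\_parent\_of}\ ufe\ x))$, with $\mathsf{None}<\mathsf{Some}\ i$ and $\mathsf{Some}\ i\le\mathsf{Some}\ j\iff i\le j$. The function $\mathsf{explain'}$. $\mathsf{explain'}$ is the recursive function, well-defined where the recursion terminates (it does under the hypotheses on $x,y$ in the claim), given by: $\mathsf{explain'}\ ufe\ x\ y=\mathsf{ReflP}\ x$ if $x=y$. Otherwise let $c=\mathsf{ufe\_lca}\ ufe\ x\ y$, $N_x=\mathsf{find\_newest\_on\_path}\ ufe\ c\ x$, $N_y=\mathsf{find\_newest\_on\_path}\ ufe\ c\ y$. If $N_y\le N_x$, with $N_x=\mathsf{Some}\ i$ and $(ax,bx)=\mathsf{unions}\ ufe\,!\,i$, the value is $\mathsf{explain'}\ ufe\ x\ ax\bigtriangledown\mathsf{AssmP}\ i\bigtriangledown\mathsf{explain'}\ ufe\ bx\ y$. Otherwise, with $N_y=\mathsf{Some}\ j$ and $(ay,by)=\mathsf{unions}\ ufe\,!\,j$, the value is $\mathsf{explain'}\ ufe\ x\ by\bigtriangledown\mathsf{SymP}(\mathsf{AssmP}\ j)\bigtriangledown\mathsf{explain'}\ ufe\ ay\ y$. -}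

module Defs where

open import Data.Bool.Base using (if_then_else_)
open import Data.Empty using (⊥-elim)
open import Data.Fin.Base using (Fin; toℕ; fromℕ<)
open import Data.Fin.Properties using (toℕ-injective; fromℕ<-injective)
open import Data.List.Base using (List; []; _∷_; _++_; _∷ʳ_; length; last; lookup)
open import Data.Maybe.Base using (Maybe; just; nothing)
open import Data.Maybe.Properties using (just-injective)
open import Data.Nat.Base using (ℕ; _<_; _≤_; _⊔_)
open import Data.Nat.Properties using (_≟_; _<?_)
open import Data.Product.Base using (∃; _×_; _,_)
open import Data.Sum.Base using (_⊎_; inj₁; inj₂)
open import Data.Vec.Base as Vec using (Vec; _[_]≔_)
open import Data.Vec.Properties using (lookup∘update; lookup∘update′)
open import Level using (0ℓ)
open import Relation.Binary.Construct.Add.Infimum.NonStrict _≤_ using (_≤₋_)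
open import Relation.Binary.Core using (Rel; _⇒_)
open import Relation.Binary.PropositionalEquality
  using (_≡_; _≢_; refl; sym; trans; cong₂; subst)
open import Relation.Nullary using (¬_; yes; no; does)
open import Relation.Unary using (Pred; _∈_)

private
  variable
    n : ℕ

Field : Rel ℕ 0ℓ → Pred ℕ 0ℓ
Field R x = ∃ λ y → R x y ⊎ R y x

------------------------------------------------------------------------
-- Union-find data structures

-- The entry of l at index i.  Indices outside l are mapped to themselves, so
-- that parents and representatives are total functions on ℕ; every notion
-- below refers to them only through hypotheses that put the indices in range.
parent : Vec ℕ n → ℕ → ℕ
parent {n} l i with i <? n
... | yes i<n = Vec.lookup l (fromℕ< i<n)
... | no  _   = i

data ReachesRoot (l : Vec ℕ n) (i : ℕ) : Set where
  root : parent l i ≡ i → ReachesRoot l i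
  step : parent l i ≢ i → ReachesRoot l (parent l i) → ReachesRoot l i

record UF (n : ℕ) : Set where
  constructor mkUF
  field
    parents : Vec ℕ n
    bounded : ∀ {i} → i < n → parent parents i < n
    reaches : ∀ {i} → i < n → ReachesRoot parents i
open UF

ufa-parent-of : UF n → ℕ → ℕ
ufa-parent-of uf = parent (parents uf)

parent-out : (l : Vec ℕ n) {i : ℕ} → ¬ i < n → parent l i ≡ i
parent-out {n} l {i} i≮n with i <? n
... | yes i<n = ⊥-elim (i≮n i<n)
... | no  _   = refl

reaches-root : (uf : UF n) (i : ℕ) → ReachesRoot (parents uf) i
reaches-root {n} uf i with i <? n
... | yes i<n = reaches uf i<n
... | no  i≮n = root (parent-out (parents uf) i≮n)

rep : {l : Vec ℕ n} {i : ℕ} → ReachesRoot l i → ℕ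
rep {i = i} (root _)   = i
rep         (step _ r) = rep r

ufa-rep-of : UF n → ℕ → ℕ
ufa-rep-of uf i = rep (reaches-root uf i)

ufa-α : UF n → Rel ℕ 0ℓ
ufa-α {n} uf x y = x < n × y < n × ufa-rep-of uf x ≡ ufa-rep-of uf y

Field⇒< : (uf : UF n) {x : ℕ} → x ∈ Field (ufa-α uf) → x < n
Field⇒< uf (_ , inj₁ (x<n , _))     = x<n
Field⇒< uf (_ , inj₂ (_ , x<n , _)) = x<n

<⇒Field : (uf : UF n) {x : ℕ} → x < n → x ∈ Field (ufa-α uf)
<⇒Field uf {x} x<n = x , inj₁ (x<n , x<n , refl)

rep-root : {l : Vec ℕ n} {i : ℕ} (r : ReachesRoot l i) → parent l (rep r) ≡ rep r
rep-root (root e)   = e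
rep-root (step _ r) = rep-root r

rep-< : (uf : UF n) {i : ℕ} (r : ReachesRoot (parents uf) i) → i < n → rep r < n
rep-< uf (root _)   i<n = i<n
rep-< uf (step _ r) i<n = rep-< uf r (bounded uf i<n)

ufa-rep-of-< : (uf : UF n) {i : ℕ} → i < n → ufa-rep-of uf i < n
ufa-rep-of-< uf {i} = rep-< uf (reaches-root uf i)

parent-update : (l : Vec ℕ n) {i : ℕ} (i<n : i < n) (v : ℕ) →
                parent (l [ fromℕ< i<n ]≔ v) i ≡ v
parent-update {n} l {i} i<n v with i <? n
... | yes i<n′ = lookup∘update (fromℕ< i<n′) l v
... | no  i≮n  = ⊥-elim (i≮n i<n)

parent-update′ : (l : Vec ℕ n) {i j : ℕ} (i<n : i < n) (v : ℕ) → j ≢ i →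
                 parent (l [ fromℕ< i<n ]≔ v) j ≡ parent l j
parent-update′ {n} l {i} {j} i<n v j≢i with j <? n
... | yes j<n = lookup∘update′ (λ e → j≢i (fromℕ<-injective j i j<n i<n e)) l v
... | no  _   = refl

module _ (uf : UF n) {r s : ℕ} (r<n : r < n) (s<n : s < n)
         (r-root : ufa-parent-of uf r ≡ r) (s-root : ufa-parent-of uf s ≡ s) where

  private
    l′ : Vec ℕ n
    l′ = parents uf [ fromℕ< r<n ]≔ s

    s-root′ : parent l′ s ≡ s
    s-root′ with s ≟ r
    ... | yes refl = parent-update (parents uf) r<n s
    ... | no  s≢r  = trans (parent-update′ (parents uf) r<n s s≢r) s-root

    bounded′ : ∀ {i} → i < n → parent l′ i < n
    bounded′ {i} i<n with i ≟ r
    ... | yes refl = subst (_< n) (sym (parent-update (parents uf) r<n s)) s<n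
    ... | no  i≢r  =
      subst (_< n) (sym (parent-update′ (parents uf) r<n s i≢r)) (bounded uf i<n)

    reaches-r : ReachesRoot l′ r
    reaches-r with parent l′ r ≟ r
    ... | yes e = root e
    ... | no ¬e = step ¬e
      (subst (ReachesRoot l′) (sym (parent-update (parents uf) r<n s)) (root s-root′))

    reaches′ : ∀ {i} → ReachesRoot (parents uf) i → ReachesRoot l′ i
    reaches′ {i} d with i ≟ r
    reaches′ d          | yes refl = reaches-r
    reaches′ (root e)   | no i≢r =
      root (trans (parent-update′ (parents uf) r<n s i≢r) e)
    reaches′ {i} (step ¬e d) | no i≢r =
      step (λ e → ¬e (trans (sym eq) e)) (subst (ReachesRoot l′) (sym eq) (reaches′ d))
      where
      eq : parent l′ i ≡ parent (parents uf) i
      eq = parent-update′ (parents uf) r<n s i≢r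

  link : UF n
  link = mkUF l′ bounded′ (λ i<n → reaches′ (reaches uf i<n))

-- Sets the entry at ufa-rep-of uf x to ufa-rep-of uf y.
ufa-union : (uf : UF n) (x y : ℕ) → x < n → y < n → UF n
ufa-union uf x y x<n y<n =
  link uf (ufa-rep-of-< uf x<n) (ufa-rep-of-< uf y<n)
    (rep-root (reaches-root uf x)) (rep-root (reaches-root uf y))

record EffUnion (uf : UF n) (a b : ℕ) : Set where
  constructor mkEffUnion
  field
    a∈Field : a ∈ Field (ufa-α uf)
    b∈Field : b ∈ Field (ufa-α uf)
    rep-a≢rep-b : ufa-rep-of uf a ≢ ufa-rep-of uf b
open EffUnion

-- EffUnions and ufa-unions are defined simultaneously, because ufa-unions is
-- only applied to lists of effective unions; the lists grow at the right, so
-- each pair is judged against the result of all the pairs preceding it.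
data EffUnions (uf : UF n) : List (ℕ × ℕ) → Set
ufa-unions : (uf : UF n) {us : List (ℕ × ℕ)} → EffUnions uf us → UF n

data EffUnions {n} uf where
  []   : EffUnions uf []
  snoc : ∀ {us a b} (es : EffUnions uf us) → EffUnion (ufa-unions uf es) a b →
         EffUnions uf (us ∷ʳ (a , b))

ufa-unions uf []                      = uf
ufa-unions uf (snoc {a = a} {b} es e) =
  ufa-union (ufa-unions uf es) a b
    (Field⇒< (ufa-unions uf es) (a∈Field e)) (Field⇒< (ufa-unions uf es) (b∈Field e))

------------------------------------------------------------------------
-- Lowest common ancestors in the union-find forest

verts-from-rep : {l : Vec ℕ n} {x : ℕ} → ReachesRoot l x → List ℕ
verts-from-rep {x = x} (root _)   = x ∷ []
verts-from-rep {x = x} (step _ r) = verts-from-rep r ++ x ∷ []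

awalk-verts-from-rep : UF n → ℕ → List ℕ
awalk-verts-from-rep uf x = verts-from-rep (reaches-root uf x)

longest-common-prefix : List ℕ → List ℕ → List ℕ
longest-common-prefix (x ∷ xs) (y ∷ ys) =
  if does (x ≟ y) then x ∷ longest-common-prefix xs ys else []
longest-common-prefix _ _ = []

-- nothing when x and y have different representatives.
ufa-lca : UF n → ℕ → ℕ → Maybe ℕ
ufa-lca uf x y =
  last (longest-common-prefix (awalk-verts-from-rep uf x) (awalk-verts-from-rep uf y))

------------------------------------------------------------------------
-- Union-find-explain data structures

record UFE (n : ℕ) : Set where
  constructor mkUFE
  field
    uf         : UF n
    α⊆Id       : ufa-α uf ⇒ _≡_
    unions     : List (ℕ × ℕ)
    eff-unions : EffUnions uf unions
open UFE public using (unions)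

uf-ds : UFE n → UF n
uf-ds ufe = ufa-unions (UFE.uf ufe) (UFE.eff-unions ufe)

ufe-rep-of : UFE n → ℕ → ℕ
ufe-rep-of ufe = ufa-rep-of (uf-ds ufe)

ufe-parent-of : UFE n → ℕ → ℕ
ufe-parent-of ufe = ufa-parent-of (uf-ds ufe)

ufe-α : UFE n → Rel ℕ 0ℓ
ufe-α ufe = ufa-α (uf-ds ufe)

ufe-lca : UFE n → ℕ → ℕ → Maybe ℕ
ufe-lca ufe = ufa-lca (uf-ds ufe)

ufe-union : (ufe : UFE n) (a b : ℕ) → EffUnion (uf-ds ufe) a b → UFE n
ufe-union (mkUFE uf α⊆Id us es) a b e = mkUFE uf α⊆Id (us ∷ʳ (a , b)) (snoc es e)

------------------------------------------------------------------------
-- explain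

infixr 5 _▽_

data Proof : Set where
  AssmP : ℕ → Proof
  ReflP : ℕ → Proof
  SymP  : Proof → Proof
  _▽_   : Proof → Proof → Proof

explain-eff : (uf : UF n) {us : List (ℕ × ℕ)} → EffUnions uf us → ℕ → ℕ → Proof
explain-eff uf []                                x y = ReflP x
explain-eff uf (snoc {us = us} {a = a} {b} es e) x y =
  if does (rep-of₀ x ≟ rep-of₀ y) then
    explain-eff uf es x y
  else if does (rep-of₀ x ≟ rep-of₀ a) then
    explain-eff uf es x a ▽ q ▽ explain-eff uf es b y
  else
    explain-eff uf es x b ▽ SymP q ▽ explain-eff uf es a y
  where
  rep-of₀ = ufa-rep-of (ufa-unions uf es)
  q = AssmP (length us)

explain : UFE n → ℕ → ℕ → Proof
explain ufe = explain-eff (UFE.uf ufe) (UFE.eff-unions ufe)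

-- The recursive equation of explain; here ufe₀ is the rollback of the
-- structure on the left-hand side.
explain-ufe-union : (ufe₀ : UFE n) (a b : ℕ) (e : EffUnion (uf-ds ufe₀) a b) (x y : ℕ) →
  let q = AssmP (length (unions ufe₀)) in
  explain (ufe-union ufe₀ a b e) x y ≡
    (if does (ufe-rep-of ufe₀ x ≟ ufe-rep-of ufe₀ y) then
       explain ufe₀ x y
     else if does (ufe-rep-of ufe₀ x ≟ ufe-rep-of ufe₀ a) then
       explain ufe₀ x a ▽ q ▽ explain ufe₀ b y
     else
       explain ufe₀ x b ▽ SymP q ▽ explain ufe₀ a y)
explain-ufe-union ufe₀ a b e x y = refl

------------------------------------------------------------------------
-- Associated unions

au-eff : (uf : UF n) {us : List (ℕ × ℕ)} → EffUnions uf us → ℕ → Maybe ℕ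
au-eff uf []                            z = nothing
au-eff uf (snoc {us = us} {a} {b} es e) z =
  if does (z ≟ ufa-rep-of (ufa-unions uf es) a) then just (length us) else au-eff uf es z

au-ds : UFE n → ℕ → Maybe ℕ
au-ds ufe = au-eff (UFE.uf ufe) (UFE.eff-unions ufe)

au-ds-ufe-union : (ufe : UFE n) (a b : ℕ) (e : EffUnion (uf-ds ufe) a b) (z : ℕ) →
  au-ds (ufe-union ufe a b e) z ≡
    (if does (z ≟ ufe-rep-of ufe a) then just (length (unions ufe)) else au-ds ufe z)
au-ds-ufe-union ufe a b e z = refl

-- Maximum with respect to _≤₋_, in which nothing is the least element.
_⊔₋_ : Maybe ℕ → Maybe ℕ → Maybe ℕ
nothing ⊔₋ m       = m
just i  ⊔₋ nothing = just i
just i  ⊔₋ just j  = just (i ⊔ j)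

newest-on-path : (ℕ → Maybe ℕ) → {l : Vec ℕ n} (y : ℕ) {x : ℕ} → ReachesRoot l x → Maybe ℕ
newest-on-path au y {x} r with y ≟ x
newest-on-path au y         r          | yes _ = nothing
newest-on-path au y         (root _)   | no  _ = nothing  -- y is not an ancestor
newest-on-path au y {x = x} (step _ r) | no  _ = au x ⊔₋ newest-on-path au y r

find-newest-on-path : UFE n → ℕ → ℕ → Maybe ℕ
find-newest-on-path ufe y x = newest-on-path (au-ds ufe) y (reaches-root (uf-ds ufe) x)

------------------------------------------------------------------------
-- explain′

-- The domain of the partial function explain′ (Bove–Capretta): a derivation
-- of Explain′Dom ufe x y is a terminating call tree of explain′ ufe x y.
data Explain′Dom (ufe : UFE n) (x y : ℕ) : Set where
  equal : x ≡ y → Explain′Dom ufe x y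

  newest-x : ∀ {c} (i : Fin (length (unions ufe))) →
    x ≢ y →
    ufe-lca ufe x y ≡ just c →
    find-newest-on-path ufe c y ≤₋ find-newest-on-path ufe c x →
    find-newest-on-path ufe c x ≡ just (toℕ i) →
    let (ax , bx) = lookup (unions ufe) i in
    Explain′Dom ufe x ax → Explain′Dom ufe bx y → Explain′Dom ufe x y

  newest-y : ∀ {c} (j : Fin (length (unions ufe))) →
    x ≢ y →
    ufe-lca ufe x y ≡ just c →
    ¬ find-newest-on-path ufe c y ≤₋ find-newest-on-path ufe c x →
    find-newest-on-path ufe c y ≡ just (toℕ j) →
    let (ay , by) = lookup (unions ufe) j in
    Explain′Dom ufe x by → Explain′Dom ufe ay y → Explain′Dom ufe x y

explain′ : (ufe : UFE n) (x y : ℕ) → Explain′Dom ufe x y → Proof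
explain′ ufe x y (equal _) = ReflP x
explain′ ufe x y (newest-x i _ _ _ _ d₁ d₂) =
  let (ax , bx) = lookup (unions ufe) i in
  explain′ ufe x ax d₁ ▽ AssmP (toℕ i) ▽ explain′ ufe bx y d₂
explain′ ufe x y (newest-y j _ _ _ _ d₁ d₂) =
  let (ay , by) = lookup (unions ufe) j in
  explain′ ufe x by d₁ ▽ SymP (AssmP (toℕ j)) ▽ explain′ ufe ay y d₂

-- The value of explain′ ufe x y depends on ufe, x and y only.
explain′-irrelevant : (ufe : UFE n) {x y : ℕ} (d d′ : Explain′Dom ufe x y) →
                      explain′ ufe x y d ≡ explain′ ufe x y d′
explain′-irrelevant ufe (equal _) (equal _) = refl
explain′-irrelevant ufe (equal e) (newest-x _ ¬e _ _ _ _ _) = ⊥-elim (¬e e)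
explain′-irrelevant ufe (equal e) (newest-y _ ¬e _ _ _ _ _) = ⊥-elim (¬e e)
explain′-irrelevant ufe (newest-x _ ¬e _ _ _ _ _) (equal e) = ⊥-elim (¬e e)
explain′-irrelevant ufe (newest-y _ ¬e _ _ _ _ _) (equal e) = ⊥-elim (¬e e)
explain′-irrelevant ufe (newest-x i _ c≡ ≤x i≡ d₁ d₂) (newest-x i′ _ c≡′ ≤x′ i≡′ d₁′ d₂′)
  with refl ← just-injective (trans (sym c≡) c≡′)
  with refl ← toℕ-injective (just-injective (trans (sym i≡) i≡′))
  = cong₂ (λ p q → p ▽ AssmP (toℕ i) ▽ q)
      (explain′-irrelevant ufe d₁ d₁′) (explain′-irrelevant ufe d₂ d₂′)
explain′-irrelevant ufe (newest-x _ _ c≡ ≤x _ _ _) (newest-y _ _ c≡′ ≰x _ _ _)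
  with refl ← just-injective (trans (sym c≡) c≡′) = ⊥-elim (≰x ≤x)
explain′-irrelevant ufe (newest-y _ _ c≡ ≰x _ _ _) (newest-x _ _ c≡′ ≤x _ _ _)
  with refl ← just-injective (trans (sym c≡) c≡′) = ⊥-elim (≰x ≤x)
explain′-irrelevant ufe (newest-y j _ c≡ _ j≡ d₁ d₂) (newest-y j′ _ c≡′ _ j≡′ d₁′ d₂′)
  with refl ← just-injective (trans (sym c≡) c≡′)
  with refl ← toℕ-injective (just-injective (trans (sym j≡) j≡′))
  = cong₂ (λ p q → p ▽ SymP (AssmP (toℕ j)) ▽ q)
      (explain′-irrelevant ufe d₁ d₁′) (explain′-irrelevant ufe d₂ d₂′)

{-# OPTIONS --safe #-}
module Submission where

-- Both functions split the explanation of x ∼ y at the union (a , b) that first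
-- joined the components of x and y.  For explain this is its recursion.  For
-- explain′: just after that union, which hangs the root r of a below the root s
-- of b, the lowest common ancestor of x and y is s, and the path to s from the
-- one that lay below r ends with the new edge, so that its newest union is
-- (a , b), while all edges on the other path are older.  Later unions only hang
-- whole trees below other roots, and so change neither the lowest common
-- ancestor nor the edges below it.  Hence the induction runs over prefixes of
-- the unions, while explain′ always refers to the full structure.

open import Defs
open import Data.Empty using (⊥-elim)
open import Data.Fin.Base using (Fin; zero; suc; toℕ)
open import Data.List.Base using (List; []; _∷_; _++_; _∷ʳ_; length; last; lookup)
open import Data.List.Membership.Propositional using (_∉_) renaming (_∈_ to _∈ˡ_)
open import Data.List.Membership.Propositional.Properties using (∈-++⁺ˡ; ∈-++⁻)
open import Data.List.Properties using (++-assoc)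
open import Data.List.Relation.Unary.Any using (here; there)
open import Data.Maybe.Base using (Maybe; just; nothing)
open import Data.Maybe.Relation.Unary.All as All using (All; just; nothing)
open import Data.Nat.Base using (ℕ; suc; _<_; _≤_)
open import Data.Nat.Properties
  using (_≟_; <⇒≤; <⇒≱; ⊔-pres-<m; m≤n⇒m⊔n≡n; n<1+n; m<n⇒m<1+n)
open import Data.Product.Base using (∃-syntax; Σ-syntax; _×_; _,_)
open import Data.Sum.Base using (inj₁; inj₂)
open import Data.Vec.Base using (Vec)
open import Relation.Binary.Construct.Add.Infimum.NonStrict _≤_ using (_≤₋_; ⊥₋≤_; [_])
open import Relation.Binary.PropositionalEquality
  using (_≡_; _≢_; refl; sym; trans; cong; cong₂; subst; subst₂)
open import Relation.Nullary using (¬_; yes; no)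
open import Relation.Nullary.Decidable using (dec-true; dec-false)
open import Relation.Unary using (_∈_)

private
  variable
    n N a b x y c : ℕ
    l : Vec ℕ n
    uf : UF n
    us vs : List (ℕ × ℕ)

-- Lists and longest common prefixes.

lookup-middle : ∀ {ℓ} {A : Set ℓ} (xs : List A) {z : A} {zs : List A} →
  Σ[ i ∈ Fin (length (xs ++ z ∷ zs)) ] toℕ i ≡ length xs × z ≡ lookup (xs ++ z ∷ zs) i
lookup-middle []       = zero , refl , refl
lookup-middle (x ∷ xs) with i , i≡ , z≡ ← lookup-middle xs = suc i , cong suc i≡ , z≡

length-∷ʳ : ∀ {ℓ} {A : Set ℓ} (xs : List A) {z : A} → length (xs ∷ʳ z) ≡ suc (length xs)
length-∷ʳ []       = refl
length-∷ʳ (x ∷ xs) = cong suc (length-∷ʳ xs)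

last-∷ : ∀ {ℓ} {A : Set ℓ} {z w : A} (zs : List A) → last zs ≡ just w → last (z ∷ zs) ≡ just w
last-∷ (_ ∷ _) e = e

lcp-∷ : ∀ z xs ys →
        longest-common-prefix (z ∷ xs) (z ∷ ys) ≡ z ∷ longest-common-prefix xs ys
lcp-∷ z xs ys rewrite dec-true (z ≟ z) refl = refl

-- Right after `r` is linked below `s`, the path of a moved element starts with `s` and `r`, while
-- that of a kept one starts with `s` and avoids `r`; so they part after `s`.
lcp-branchˡ : ∀ {r s xs ys} → ∃[ xs′ ] xs ≡ r ∷ xs′ → ∃[ ys′ ] ys ≡ s ∷ ys′ → r ∉ ys →
              longest-common-prefix (s ∷ xs) ys ≡ s ∷ []
lcp-branchˡ {r} {s} (xs , refl) ([] , refl) r∉ = lcp-∷ s (r ∷ xs) []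
lcp-branchˡ {r} {s} (xs , refl) (y ∷ ys , refl) r∉
  rewrite dec-true (s ≟ s) refl | dec-false (r ≟ y) (λ r≡y → r∉ (there (here r≡y))) = refl

lcp-branchʳ : ∀ {r s xs ys} → ∃[ xs′ ] xs ≡ s ∷ xs′ → ∃[ ys′ ] ys ≡ r ∷ ys′ → r ∉ xs →
              longest-common-prefix xs (s ∷ ys) ≡ s ∷ []
lcp-branchʳ {r} {s} ([] , refl) (ys , refl) r∉ = lcp-∷ s [] (r ∷ ys)
lcp-branchʳ {r} {s} (x ∷ xs , refl) (ys , refl) r∉
  rewrite dec-true (s ≟ s) refl | dec-false (x ≟ r) (λ x≡r → r∉ (there (here (sym x≡r)))) = refl

-- Vertices on the path from a representative.

verts-head : (d : ReachesRoot l x) → ∃[ ws ] verts-from-rep d ≡ rep d ∷ ws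
verts-head (root _) = [] , refl
verts-head {x = x} (step _ d) with ws , e ← verts-head d = ws ++ x ∷ [] , cong (_++ x ∷ []) e

rep∈verts : (d : ReachesRoot l x) → rep d ∈ˡ verts-from-rep d
rep∈verts (root _)   = here refl
rep∈verts (step _ d) = ∈-++⁺ˡ (rep∈verts d)

-- Each vertex after the first stems from a `step`, which carries a proof that it is no root. Hence
-- a root lies on no path of another tree.
root∈verts : (d : ReachesRoot l x) → parent l c ≡ c → c ∈ˡ verts-from-rep d → c ≡ rep d
root∈verts (root _) c-root (here c≡x) = c≡x
root∈verts (step ¬e d) c-root c∈ with ∈-++⁻ (verts-from-rep d) c∈
... | inj₁ c∈d         = root∈verts d c-root c∈d
... | inj₂ (here refl) = ⊥-elim (¬e c-root)

-- Bounds on the newest union of a path.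

⊔₋-< : ∀ {m m′} → All (_< N) m → All (_< N) m′ → All (_< N) (m ⊔₋ m′)
⊔₋-< nothing  q        = q
⊔₋-< (just p) nothing  = just p
⊔₋-< (just p) (just q) = just (⊔-pres-<m p q)

⊔₋-absorb : ∀ {m} → All (_< N) m → m ⊔₋ just N ≡ just N
⊔₋-absorb nothing  = refl
⊔₋-absorb (just p) = cong just (m≤n⇒m⊔n≡n (<⇒≤ p))

<⇒≤₋ : ∀ {m} → All (_< N) m → m ≤₋ just N
<⇒≤₋ nothing  = ⊥₋≤ _
<⇒≤₋ (just p) = [ <⇒≤ p ]

<⇒≱₋ : ∀ {m} → All (_< N) m → ¬ just N ≤₋ m
<⇒≱₋ (just p) [ q ] = <⇒≱ p q

newest-< : ∀ {au} → (∀ z → All (_< N) (au z)) →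
           ∀ c (d : ReachesRoot l x) → All (_< N) (newest-on-path au c d)
newest-< {x = x} au< c d with c ≟ x
newest-<         au< c d          | yes _ = nothing
newest-<         au< c (root _)   | no _  = nothing
newest-< {x = x} au< c (step _ d) | no _  = ⊔₋-< (au< x) (newest-< au< c d)

-- How hanging the root `r` below the root `s` changes paths.

module Linking {l l′ : Vec ℕ n} {r s : ℕ} (r-root : parent l r ≡ r) (s-root : parent l s ≡ s)
               (r≢s : r ≢ s) (r-parent : parent l′ r ≡ s)
               (unchanged : ∀ {z} → z ≢ r → parent l′ z ≡ parent l z) where

  -- The indices are kept apart, since parent l x and parent l′ x agree only
  -- propositionally and cannot be unified.
  data Linked : ∀ {x y} → ReachesRoot l x → ReachesRoot l′ y → Set where
    same-root : ∀ {x e e′} → x ≢ r → Linked {x} {x} (root e) (root e′)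
    new-edge  : ∀ {e ¬e e′} → Linked {r} {r} (root e) (step ¬e (root e′))
    step      : ∀ {x d d′ ¬e ¬e′} → Linked d d′ → Linked {x} {x} (step ¬e d) (step ¬e′ d′)

  nonroot≢r : ∀ {z} → parent l z ≢ z → z ≢ r
  nonroot≢r ¬e refl = ¬e r-root

  s-root′ : parent l′ s ≡ s
  s-root′ = trans (unchanged (λ e → r≢s (sym e))) s-root

  -- Non-roots of `l` differ from `r`, so both derivations take the same parents there. Only at `r`
  -- does the new one take a further edge, and it stops at `s`, which is still a root.
  linked : ∀ {x y} (d : ReachesRoot l x) (d′ : ReachesRoot l′ y) → x ≡ y → Linked d d′
  linked (root e) (root e′) refl = same-root λ { refl → r≢s (trans (sym e′) r-parent) }
  linked {x} (root e) (step ¬e d′) refl with x ≟ r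
  linked (root e) (step ¬e (root _))    refl | yes refl = new-edge
  linked (root e) (step ¬e (step ¬e′ _)) refl | yes refl =
    ⊥-elim (¬e′ (subst (λ z → parent l′ z ≡ z) (sym r-parent) s-root′))
  linked (root e) (step ¬e d′) refl | no x≢r = ⊥-elim (¬e (trans (unchanged x≢r) e))
  linked (step ¬e d) (root e) refl =
    ⊥-elim (¬e (trans (sym (unchanged (nonroot≢r ¬e))) e))
  linked (step ¬e d) (step ¬e′ d′) refl =
    step (linked d d′ (sym (unchanged (nonroot≢r ¬e))))

  data Walk {x y} (d : ReachesRoot l x) (d′ : ReachesRoot l′ y) : Set where
    moved : rep d ≡ r → rep d′ ≡ s → verts-from-rep d′ ≡ s ∷ verts-from-rep d → Walk d d′
    kept  : rep d ≢ r → rep d′ ≡ rep d → verts-from-rep d′ ≡ verts-from-rep d → Walk d d′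

  walk : ∀ {x y} {d : ReachesRoot l x} {d′ : ReachesRoot l′ y} → Linked d d′ → Walk d d′
  walk (same-root x≢r) = kept x≢r refl refl
  walk new-edge        = moved refl r-parent (cong (λ z → z ∷ r ∷ []) r-parent)
  walk (step {x} k) with walk k
  ... | moved e e′ v = moved e e′ (cong (_++ x ∷ []) v)
  ... | kept  e e′ v = kept e e′ (cong (_++ x ∷ []) v)

  module _ {au au′ : ℕ → Maybe ℕ} (au-unchanged : ∀ {z} → z ≢ r → au′ z ≡ au z) where

    -- As `c` lies on the old path, the search stops before it could follow the new edge, and every
    -- label it reads belongs to a non-root of `l`, hence not to `r`.
    newest-unchanged : ∀ {x y c} {d : ReachesRoot l x} {d′ : ReachesRoot l′ y} → Linked d d′ →
      c ∈ˡ verts-from-rep d → newest-on-path au′ c d′ ≡ newest-on-path au c d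
    newest-unchanged {c = c} (same-root {x} _) _ with c ≟ x
    ... | yes _ = refl
    ... | no _  = refl
    newest-unchanged new-edge (here refl) with r ≟ r
    ... | yes _  = refl
    ... | no r≢r = ⊥-elim (r≢r refl)
    newest-unchanged {c = c} (step {x} {d} {¬e = ¬e} k) c∈ with c ≟ x | ∈-++⁻ (verts-from-rep d) c∈
    ... | yes _  | _               = refl
    ... | no _   | inj₁ c∈d        =
      cong₂ _⊔₋_ (au-unchanged (nonroot≢r ¬e)) (newest-unchanged k c∈d)
    ... | no c≢x | inj₂ (here c≡x) = ⊥-elim (c≢x c≡x)

    -- The search for `s` ends with the edge at `r`, labelled `N`; all labels read before are older
    -- and are absorbed by the maximum.
    newest-moved : ∀ {x y N} {d : ReachesRoot l x} {d′ : ReachesRoot l′ y} → Linked d d′ →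
      au′ r ≡ just N → (∀ z → All (_< N) (au z)) → rep d ≡ r →
      newest-on-path au′ s d′ ≡ just N
    newest-moved (same-root x≢r) au′-r au< rep≡r = ⊥-elim (x≢r rep≡r)
    newest-moved new-edge au′-r au< _ with s ≟ r
    ... | yes s≡r = ⊥-elim (r≢s (sym s≡r))
    -- Beyond `r` only a `root` is left, where the search yields `nothing` under either outcome of
    -- the test; the split merely lets it reduce.
    ... | no _ with s ≟ parent l′ r
    ...   | yes _ rewrite au′-r = refl
    ...   | no _  rewrite au′-r = refl
    newest-moved (step {x} {¬e = ¬e} k) au′-r au< rep≡r with s ≟ x
    ... | yes refl = ⊥-elim (¬e s-root)
    ... | no _ rewrite newest-moved k au′-r au< rep≡r | au-unchanged (nonroot≢r ¬e) =
      ⊔₋-absorb (au< x)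

-- Lowest common ancestors and newest unions under one more union.

au-eff-< : (es : EffUnions uf us) → ∀ z → All (_< length us) (au-eff uf es z)
au-eff-< [] z = nothing
au-eff-< {uf = uf} (snoc {us = us} {a} {b} es e) z
  rewrite length-∷ʳ us {a , b} with z ≟ ufa-rep-of (ufa-unions uf es) a
... | yes z≡ rewrite dec-true (z ≟ ufa-rep-of (ufa-unions uf es) a) z≡  = just (n<1+n _)
... | no z≢  rewrite dec-false (z ≟ ufa-rep-of (ufa-unions uf es) a) z≢ =
  All.map m<n⇒m<1+n (au-eff-< es z)

-- `same-rep`, `c∈x` and `c∈y` make the remaining fields survive later unions: `x` and `y` are moved
-- together, and new edges appear only above `c`.
record Meet {n} {uf : UF n} (es : EffUnions uf us) (x y c : ℕ) (mx my : Maybe ℕ) : Set where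
  private
    final : UF n
    final = ufa-unions uf es
  field
    same-rep : ufa-rep-of final x ≡ ufa-rep-of final y
    lca≡     : ufa-lca final x y ≡ just c
    c∈x      : c ∈ˡ awalk-verts-from-rep final x
    c∈y      : c ∈ˡ awalk-verts-from-rep final y
    newest-x≡ : newest-on-path (au-eff uf es) c (reaches-root final x) ≡ mx
    newest-y≡ : newest-on-path (au-eff uf es) c (reaches-root final y) ≡ my

module Snoc {n} {uf : UF n} {us a b} (es : EffUnions uf us)
            (e : EffUnion (ufa-unions uf es) a b) where

  old new : UF n
  old = ufa-unions uf es
  new = ufa-unions uf (snoc es e)

  r s : ℕ
  r = ufa-rep-of old a
  s = ufa-rep-of old b

  r<n : r < n
  r<n = ufa-rep-of-< old (Field⇒< old (EffUnion.a∈Field e))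

  open Linking {l = UF.parents old} {l′ = UF.parents new}
    (rep-root (reaches-root old a)) (rep-root (reaches-root old b)) (EffUnion.rep-a≢rep-b e)
    (parent-update (UF.parents old) r<n s)
    (λ {z} → parent-update′ (UF.parents old) r<n s)

  au-r : au-eff uf (snoc es e) r ≡ just (length us)
  au-r rewrite dec-true (r ≟ r) refl = refl

  au-unchanged : ∀ {z} → z ≢ r → au-eff uf (snoc es e) z ≡ au-eff uf es z
  au-unchanged {z} z≢r rewrite dec-false (z ≟ r) z≢r = refl

  linked-at : ∀ z → Linked (reaches-root old z) (reaches-root new z)
  linked-at z = linked (reaches-root old z) (reaches-root new z) refl

  walk-at : ∀ z → Walk (reaches-root old z) (reaches-root new z)
  walk-at z = walk (linked-at z)

  r∉ : ∀ {z} → ufa-rep-of old z ≢ r → r ∉ awalk-verts-from-rep old z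
  r∉ {z} z≁r r∈ =
    z≁r (sym (root∈verts (reaches-root old z) (rep-root (reaches-root old a)) r∈))

  newest-kept : ∀ {z c m} → c ∈ˡ awalk-verts-from-rep old z →
    newest-on-path (au-eff uf es) c (reaches-root old z) ≡ m →
    newest-on-path (au-eff uf (snoc es e)) c (reaches-root new z) ≡ m
  newest-kept {z} c∈ = trans (newest-unchanged au-unchanged (linked-at z) c∈)

  verts-⊆ : ∀ {z c} → c ∈ˡ awalk-verts-from-rep old z → c ∈ˡ awalk-verts-from-rep new z
  verts-⊆ {z} {c} c∈ with walk-at z
  ... | moved _ _ v = subst (c ∈ˡ_) (sym v) (there c∈)
  ... | kept  _ _ v = subst (c ∈ˡ_) (sym v) c∈

  -- Having equal representatives, `x` and `y` are either both moved, so that both paths gain the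
  -- first vertex `s`, or both kept. Neither changes the last common vertex.
  meet-snoc : ∀ {x y c mx my} → Meet es x y c mx my → Meet (snoc es e) x y c mx my
  meet-snoc {x} {y} {c} m = record
    { same-rep  = rep′≡
    ; lca≡      = lca′≡
    ; c∈x       = verts-⊆ {x} (Meet.c∈x m)
    ; c∈y       = verts-⊆ {y} (Meet.c∈y m)
    ; newest-x≡ = newest-kept {x} (Meet.c∈x m) (Meet.newest-x≡ m)
    ; newest-y≡ = newest-kept {y} (Meet.c∈y m) (Meet.newest-y≡ m)
    }
    where
    vx = awalk-verts-from-rep old x
    vy = awalk-verts-from-rep old y

    rep′≡ : ufa-rep-of new x ≡ ufa-rep-of new y
    rep′≡ with walk-at x | walk-at y
    ... | moved _ p _ | moved _ q _ = trans p (sym q)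
    ... | kept  _ p _ | kept  _ q _ = trans p (trans (Meet.same-rep m) (sym q))
    ... | moved p _ _ | kept  q _ _ = ⊥-elim (q (trans (sym (Meet.same-rep m)) p))
    ... | kept  p _ _ | moved q _ _ = ⊥-elim (p (trans (Meet.same-rep m) q))

    lca′≡ : ufa-lca new x y ≡ just c
    lca′≡ with walk-at x | walk-at y
    ... | moved _ _ p | moved _ _ q =
      trans (cong last (trans (cong₂ longest-common-prefix p q) (lcp-∷ s vx vy)))
            (last-∷ (longest-common-prefix vx vy) (Meet.lca≡ m))
    ... | kept  _ _ p | kept  _ _ q =
      trans (cong last (cong₂ longest-common-prefix p q)) (Meet.lca≡ m)
    ... | moved p _ _ | kept  q _ _ = ⊥-elim (q (trans (sym (Meet.same-rep m)) p))
    ... | kept  p _ _ | moved q _ _ = ⊥-elim (p (trans (Meet.same-rep m) q))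

  head-≡ : ∀ z {t} → ufa-rep-of old z ≡ t → ∃[ ws ] awalk-verts-from-rep old z ≡ t ∷ ws
  head-≡ z refl = verts-head (reaches-root old z)

  rep∈ : ∀ z {t} → ufa-rep-of old z ≡ t → t ∈ˡ awalk-verts-from-rep old z
  rep∈ z refl = rep∈verts (reaches-root old z)

  -- The bound on `m` decides the comparison of newest unions in `explain′`: it succeeds in the
  -- first case and fails in the second.
  data Joined (x y : ℕ) : Set where
    forward  : ∀ {m} → ufa-rep-of old x ≡ r → ufa-rep-of old y ≡ s →
               All (_< length us) m → Meet (snoc es e) x y s (just (length us)) m → Joined x y
    backward : ∀ {m} → ufa-rep-of old x ≡ s → ufa-rep-of old y ≡ r →
               All (_< length us) m → Meet (snoc es e) x y s m (just (length us)) → Joined x y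

  -- Exactly one of `x` and `y` is moved: two moved elements would both come from the tree of `r`,
  -- and two kept ones would still have different representatives.
  joined : ∀ {x y} → ufa-rep-of old x ≢ ufa-rep-of old y →
           ufa-rep-of new x ≡ ufa-rep-of new y → Joined x y
  joined {x} {y} x≁y x∼y with walk-at x | walk-at y
  ... | moved p _ _ | moved q _ _ = ⊥-elim (x≁y (trans p (sym q)))
  ... | kept  _ p _ | kept  _ q _ = ⊥-elim (x≁y (trans (sym p) (trans x∼y q)))
  ... | moved p p′ vx | kept q q′ vy = forward p y∼s
    (newest-< (au-eff-< es) s (reaches-root old y))
    record
      { same-rep  = x∼y
      ; lca≡      = cong last (trans (cong₂ longest-common-prefix vx vy)
                                     (lcp-branchˡ (head-≡ x p) (head-≡ y y∼s) (r∉ {y} q)))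
      ; c∈x       = subst (s ∈ˡ_) (sym vx) (here refl)
      ; c∈y       = verts-⊆ {y} (rep∈ y y∼s)
      ; newest-x≡ = newest-moved au-unchanged (linked-at x) au-r (au-eff-< es) p
      ; newest-y≡ = newest-kept {y} (rep∈ y y∼s) refl
      }
    where
    y∼s : ufa-rep-of old y ≡ s
    y∼s = trans (sym q′) (trans (sym x∼y) p′)
  ... | kept p p′ vx | moved q q′ vy = backward x∼s q
    (newest-< (au-eff-< es) s (reaches-root old x))
    record
      { same-rep  = x∼y
      ; lca≡      = cong last (trans (cong₂ longest-common-prefix vx vy)
                                     (lcp-branchʳ (head-≡ x x∼s) (head-≡ y q) (r∉ {x} p)))
      ; c∈x       = verts-⊆ {x} (rep∈ x x∼s)
      ; c∈y       = subst (s ∈ˡ_) (sym vy) (here refl)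
      ; newest-x≡ = newest-kept {x} (rep∈ x x∼s) refl
      ; newest-y≡ = newest-moved au-unchanged (linked-at y) au-r (au-eff-< es) q
      }
    where
    x∼s : ufa-rep-of old x ≡ s
    x∼s = trans (sym p′) (trans x∼y q′)

  explain-same : ∀ {x y} → ufa-rep-of old x ≡ ufa-rep-of old y →
    explain-eff uf (snoc es e) x y ≡ explain-eff uf es x y
  explain-same {x} {y} x∼y rewrite dec-true (ufa-rep-of old x ≟ ufa-rep-of old y) x∼y = refl

  explain-forward : ∀ {x y} → ufa-rep-of old x ≢ ufa-rep-of old y → ufa-rep-of old x ≡ r →
    explain-eff uf (snoc es e) x y ≡
    explain-eff uf es x a ▽ AssmP (length us) ▽ explain-eff uf es b y
  explain-forward {x} {y} x≁y x∼a
    rewrite dec-false (ufa-rep-of old x ≟ ufa-rep-of old y) x≁y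
          | dec-true (ufa-rep-of old x ≟ r) x∼a = refl

  explain-backward : ∀ {x y} → ufa-rep-of old x ≢ ufa-rep-of old y → ufa-rep-of old x ≢ r →
    explain-eff uf (snoc es e) x y ≡
    explain-eff uf es x b ▽ SymP (AssmP (length us)) ▽ explain-eff uf es a y
  explain-backward {x} {y} x≁y x≁a
    rewrite dec-false (ufa-rep-of old x ≟ ufa-rep-of old y) x≁y
          | dec-false (ufa-rep-of old x ≟ r) x≁a = refl

-- Prefixes of the sequence of unions.

infix 4 _⊑_

-- A relation between derivations, not lists, so that induction on it supplies each later union with
-- the proof of effectiveness that `meet-snoc` takes.
data _⊑_ {n} {uf : UF n} (es : EffUnions uf us) : EffUnions uf vs → Set where
  ⊑-refl : es ⊑ es
  ⊑-snoc : ∀ {vs a b} {fs : EffUnions uf vs} {e : EffUnion (ufa-unions uf fs) a b} →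
           es ⊑ fs → es ⊑ snoc fs e

⊑-init : {es : EffUnions uf us} {e : EffUnion (ufa-unions uf es) a b} {fs : EffUnions uf vs} →
         snoc es e ⊑ fs → es ⊑ fs
⊑-init ⊑-refl     = ⊑-snoc ⊑-refl
⊑-init (⊑-snoc p) = ⊑-snoc (⊑-init p)

⊑-split : {es : EffUnions uf us} {e : EffUnion (ufa-unions uf es) a b} {fs : EffUnions uf vs} →
          snoc es e ⊑ fs → ∃[ ws ] vs ≡ us ++ (a , b) ∷ ws
⊑-split ⊑-refl = [] , refl
⊑-split {us = us} {a} {b} (⊑-snoc {a = a′} {b′} p) with ws , refl ← ⊑-split p =
  ws ∷ʳ (a′ , b′) , ++-assoc us ((a , b) ∷ ws) ((a′ , b′) ∷ [])

-- Unions are only appended, so each keeps its position. This is why both functions name it by the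
-- same `AssmP`.
⊑-lookup : {es : EffUnions uf us} {e : EffUnion (ufa-unions uf es) a b} {fs : EffUnions uf vs} →
           snoc es e ⊑ fs → Σ[ i ∈ Fin (length vs) ] toℕ i ≡ length us × (a , b) ≡ lookup vs i
⊑-lookup {us = us} p with ws , refl ← ⊑-split p = lookup-middle us

meet-⊑ : ∀ {m m′} {es : EffUnions uf us} {fs : EffUnions uf vs} → es ⊑ fs →
         Meet es x y c m m′ → Meet fs x y c m m′
meet-⊑ ⊑-refl m = m
meet-⊑ (⊑-snoc {fs = fs} {e} p) m = Snoc.meet-snoc fs e (meet-⊑ p m)

-- The induction over prefixes.

module _ (ufe : UFE n) where

  private
    all : EffUnions (UFE.uf ufe) (unions ufe)
    all = UFE.eff-unions ufe

  -- Matching on both equations turns `k` and the pair into what `explain′` reads at `i`, so that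
  -- its unfolding is `refl`.
  split-x : ∀ {k m} (i : Fin (length (unions ufe))) →
    toℕ i ≡ k → (a , b) ≡ lookup (unions ufe) i → x ≢ y →
    Meet all x y c (just k) m → All (_< k) m →
    (d₁ : Explain′Dom ufe x a) (d₂ : Explain′Dom ufe b y) →
    Σ[ d ∈ Explain′Dom ufe x y ]
      explain′ ufe x a d₁ ▽ AssmP k ▽ explain′ ufe b y d₂ ≡ explain′ ufe x y d
  split-x i refl refl x≢y meet m< d₁ d₂ = newest-x i x≢y lca≡ y≤x newest-x≡ d₁ d₂ , refl
    where
    open Meet meet
    y≤x = subst₂ _≤₋_ (sym newest-y≡) (sym newest-x≡) (<⇒≤₋ m<)

  split-y : ∀ {k m} (i : Fin (length (unions ufe))) →
    toℕ i ≡ k → (a , b) ≡ lookup (unions ufe) i → x ≢ y →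
    Meet all x y c m (just k) → All (_< k) m →
    (d₁ : Explain′Dom ufe x b) (d₂ : Explain′Dom ufe a y) →
    Σ[ d ∈ Explain′Dom ufe x y ]
      explain′ ufe x b d₁ ▽ SymP (AssmP k) ▽ explain′ ufe a y d₂ ≡ explain′ ufe x y d
  split-y i refl refl x≢y meet m< d₁ d₂ = newest-y i x≢y lca≡ y≰x newest-y≡ d₁ d₂ , refl
    where
    open Meet meet
    -- Strictness of the bound counts here: equal labels would select the other branch.
    y≰x = λ y≤x → <⇒≱₋ m< (subst₂ _≤₋_ newest-y≡ newest-x≡ y≤x)

  -- The call tree of `explain′` is built alongside the equation, so its termination is inherited
  -- from the recursion on `es`.
  explained : (es : EffUnions (UFE.uf ufe) us) → es ⊑ all → x < n → y < n →
    ufa-rep-of (ufa-unions (UFE.uf ufe) es) x ≡ ufa-rep-of (ufa-unions (UFE.uf ufe) es) y →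
    Σ[ d ∈ Explain′Dom ufe x y ] explain-eff (UFE.uf ufe) es x y ≡ explain′ ufe x y d
  explained {x = x} {y} [] _ x<n y<n x∼y = equal (UFE.α⊆Id ufe (x<n , y<n , x∼y)) , refl
  explained {x = x} {y} (snoc {us = us} es e) p x<n y<n x∼y
    with ufa-rep-of (ufa-unions (UFE.uf ufe) es) x ≟ ufa-rep-of (ufa-unions (UFE.uf ufe) es) y
  ... | yes x∼₀y with d , eq ← explained es (⊑-init p) x<n y<n x∼₀y =
    d , trans (Snoc.explain-same es e x∼₀y) eq
  ... | no x≁₀y with Snoc.joined es e x≁₀y x∼y | ⊑-lookup p
  ...   | Snoc.forward x∼a y∼b m< meet | i , i≡ , ab≡
    with d₁ , eq₁ ← explained es (⊑-init p) x<n (Field⇒< (Snoc.old es e) (EffUnion.a∈Field e)) x∼a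
       | d₂ , eq₂ ← explained es (⊑-init p) (Field⇒< (Snoc.old es e) (EffUnion.b∈Field e)) y<n (sym y∼b)
    with d , eq ← split-x i i≡ ab≡ (λ { refl → x≁₀y refl }) (meet-⊑ p meet) m< d₁ d₂ =
    d , trans (Snoc.explain-forward es e x≁₀y x∼a)
        (trans (cong₂ (λ t u → t ▽ AssmP (length us) ▽ u) eq₁ eq₂) eq)
  explained {x = x} {y} (snoc {us = us} es e) p x<n y<n x∼y
    | no x≁₀y | Snoc.backward x∼b y∼a m< meet | i , i≡ , ab≡
    with d₁ , eq₁ ← explained es (⊑-init p) x<n (Field⇒< (Snoc.old es e) (EffUnion.b∈Field e)) x∼b
       | d₂ , eq₂ ← explained es (⊑-init p) (Field⇒< (Snoc.old es e) (EffUnion.a∈Field e)) y<n (sym y∼a)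
    with d , eq ← split-y i i≡ ab≡ (λ { refl → x≁₀y refl }) (meet-⊑ p meet) m< d₁ d₂ =
    -- `explain` tests `x` against `a` alone: if they shared a class, `x` would already be joined to
    -- `y`, which lies with `a`.
    d , trans (Snoc.explain-backward es e x≁₀y (λ x∼a → x≁₀y (trans x∼a (sym y∼a))))
        (trans (cong₂ (λ t u → t ▽ SymP (AssmP (length us)) ▽ u) eq₁ eq₂) eq)

theorem4 : ∀ {n : ℕ} (ufe : UFE n) (x y : ℕ) →
    x ∈ Field (ufe-α ufe) → y ∈ Field (ufe-α ufe) →
    ufe-rep-of ufe x ≡ ufe-rep-of ufe y →
    Σ[ d ∈ Explain′Dom ufe x y ] explain ufe x y ≡ explain′ ufe x y d
theorem4 ufe x y x∈ y∈ =
  explained ufe (UFE.eff-unions ufe) ⊑-refl (Field⇒< (uf-ds ufe) x∈) (Field⇒< (uf-ds ufe) y∈)
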